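{- Let $g\ge 1$ be an integer and let $A=\{a_1<\cdots<a_m\}\subset\mathbb N$ be a $\mathcal D[g]$ set. Then $$a_m\ \ge\ \frac1g\binom{m}{\lfloor m/2\rfloor}-1,$$ and hence $\binom{m}{\lfloor m/2\rfloor}\le g(a_m+1)$.
   Context: For a positive integer $g$, a set $\mathcal S=\{a_1<a_2<\cdots\}\subset\mathbb N$ (finite or infinite) is a $\mathcal D[g]$ set if for every $m$ (for which $a_m$ exists) and every $t\in\mathbb Z$, $$\left|\left\{I\subseteq\{1,\dots,m\}:\ \sum_{i\in I}a_i=t\right\}\right|\le g.$$ -}

module Defs where

open import Algebra.Definitions.RawMonoid using (sum)
open import Data.Bool.Base using (if_then_else_)
open import Data.Fin.Base as Fin using (Fin; inject≤)
open import Data.Fin.Subset using (Subset; inside; outside)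
open import Data.Integer.Base using (ℤ; +_)
import Data.Integer.Properties as ℤ
open import Data.List.Base using (List; [_]; _++_; map; filter; length)
open import Data.Nat.Base using (ℕ; zero; suc; _≤_; _<_; +-0-rawMonoid)
open import Data.Vec.Base using ([]; _∷_; lookup)
open import Data.Vec.Functional using (Vector)
open import Relation.Binary.Definitions using (Monotonic₁)

-- A finite set {a₁ < ⋯ < aₘ} of naturals is represented by its increasing
-- enumeration, with aᵢ₊₁ at index i.
StrictlyIncreasing : ∀ {m} → Vector ℕ m → Set
StrictlyIncreasing a = Monotonic₁ Fin._<_ _<_ a

subsets : ∀ k → List (Subset k)
subsets zero    = [ [] ]
subsets (suc k) = map (outside ∷_) (subsets k) ++ map (inside ∷_) (subsets k)

subsetSum : ∀ {k} → Vector ℕ k → Subset k → ℕ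
subsetSum a I = sum +-0-rawMonoid (λ i → if lookup I i then a i else 0)

-- Subsets are counted as index sets, so distinct I with equal sums are
-- counted separately.
representations : ∀ {k} → Vector ℕ k → ℤ → ℕ
representations {k} a t = length (filter (λ I → + subsetSum a I ℤ.≟ t) (subsets k))

𝒟[_] : ℕ → ∀ {m} → Vector ℕ m → Set
𝒟[ g ] {m} a = ∀ k → 1 ≤ k → (k≤m : k ≤ m) → (t : ℤ) →
  representations (λ (i : Fin k) → a (inject≤ i k≤m)) t ≤ g

{-# OPTIONS --safe #-}
module Submission where

-- Let A = aₘ, let s be the subset-sum function and N(t) = #{I : s(I) < t}.
-- The down-sets {s < t} satisfy an isoperimetric inequality in the style of
-- Harper: passing from t to t + A enlarges N(t) at least as much as passing
-- from a Hamming ball to the ball of radius one larger.  It is proved by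
-- splitting on one element e, which replaces N(t) by N(t − e) and N(t) for the
-- remaining elements.  By complementation, at least half of all subsets have sum
-- at most the median and at most half have sum strictly below it; for odd m half
-- of the cube is the size of a Hamming ball, so a window of A + 1 values around
-- the median contains at least C(m, ⌊m/2⌋) sums, and each value
-- is attained at most g times.  For even m, remove the largest element first:
-- the window then splits into two mirror-image windows for m − 1.

open import Defs
open import Algebra.Definitions.RawMonoid using (sum)
open import Data.Bool.Base using (true; false; if_then_else_)
open import Data.Fin.Base using (zero; suc; inject≤; inject₁; fromℕ)
import Data.Fin.Properties as Fin
open import Data.Fin.Subset using (Subset; inside; outside)
open import Data.Integer.Base as ℤ using (ℤ; +_; +≤+)
import Data.Integer.Properties as ℤ
import Data.Integer.Tactic.RingSolver as ℤ
open import Data.List.Base as List using (_∷_; filter; length)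
import Data.List.Properties as List
open import Data.Nat.Combinatorics using (_C_; nCk≡nC[n∸k]; nCk+nC[k+1]≡[n+1]C[k+1])
open import Data.Product.Base using (_×_; _,_; ∃-syntax)
open import Data.Sum.Base using (_⊎_; inj₁; inj₂)
import Data.Vec.Base as Vec
open import Data.Vec.Functional using (Vector; head; tail; init; last)
open import Function.Base using (_∘_)
open import Level using (0ℓ)
open import Relation.Binary.Definitions using (tri<; tri≈; tri>)
open import Relation.Binary.PropositionalEquality
open import Relation.Nullary using (yes; no; does; contradiction)
open import Relation.Nullary.Decidable using (dec-true; dec-false)
open import Relation.Unary using (Pred; Decidable)

-- Isoperimetric inequality, in terms of sizes alone

module Isoperimetry where
  open import Data.Integer.Base hiding (suc)
  open import Data.Integer.Properties
  open import Data.Integer.Tactic.RingSolver using (solve-∀)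
  open import Data.Nat.Base as ℕ using (ℕ; zero; suc; s≤s; z≤n)
  import Data.Nat.Properties as ℕ

  infixl 6 _⊕_
  infixl 7 _⊗_

  _⊕_ : ∀ {i j} → 0ℤ ≤ i → 0ℤ ≤ j → 0ℤ ≤ i + j
  _⊕_ = +-mono-≤

  _⊗_ : ∀ {i j} → 0ℤ ≤ i → 0ℤ ≤ j → 0ℤ ≤ i * j
  _⊗_ {i} {j} p q = subst (_≤ i * j) (*-zeroʳ i) (*-monoˡ-≤-nonNeg i {{nonNegative p}} q)

  -- Linear inequalities below are proved by exhibiting the difference of the two
  -- sides as a nonnegative combination of the gaps of the hypotheses.
  certify : ∀ {d l r} → 0ℤ ≤ d → d ≡ r - l → l ≤ r
  certify {l = l} {r} p eq = 0≤i-j⇒j≤i {r} {l} (subst (0ℤ ≤_) eq p)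

  gap : ∀ {i j} → i ≤ j → 0ℤ ≤ j - i
  gap = i≤j⇒0≤j-i

  -- The inductive step in abstract form: a, b, c are three consecutive ball sizes in
  -- dimension m and x = m − n; u ≤ v are the sizes of the two halves of a down-set,
  -- u⁺ and v⁺ those of their enlargements.
  module _
    (n : ℕ) {x a b c u v u⁺ v⁺ : ℤ}
    (0≤x : 0ℤ ≤ x) (b≤c : b ≤ c) (slope : +[1+ n ] * (c - b) ≡ x * (b - a))
    (u≤v : u ≤ v) (v≤u⁺ : v ≤ u⁺) (v≤v⁺ : v ≤ v⁺)
    (lowᵤ : ∀ w → a < w → w ≤ b → w ≤ u → x * (w - a) ≤ +[1+ n ] * (u⁺ - b))
    (lowᵥ : ∀ w → a < w → w ≤ b → w ≤ v → x * (w - a) ≤ +[1+ n ] * (v⁺ - b))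
    (highᵤ : ∀ w → b < w → w ≤ c → w ≤ u → (x - 1ℤ) * (w - b) ≤ +[1+ suc n ] * (u⁺ - c))
    (highᵥ : ∀ w → b < w → w ≤ c → w ≤ v → (x - 1ℤ) * (w - b) ≤ +[1+ suc n ] * (v⁺ - c))
    where

    private
      κ : ℤ
      κ = +[1+ n ]

      0≤κ : 0ℤ ≤ κ
      0≤κ = +≤+ ℕ.z≤n

      0≤1+κ : 0ℤ ≤ 1ℤ + κ
      0≤1+κ = +≤+ ℕ.z≤n

      slope-≥ : 0ℤ ≤ κ * (c - b) - x * (b - a)
      slope-≥ = gap (≤-reflexive (sym slope))

      slope-≤ : 0ℤ ≤ x * (b - a) - κ * (c - b)
      slope-≤ = gap (≤-reflexive slope)

    -- By Pascal's rule `a + b` and `b + c` are consecutive ball sizes in dimension m + 1, so this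
    -- is the growth bound for a whole down-set of size u + v.
    MergeBound : ℤ → Set
    MergeBound w = x * (w - (a + b)) ≤ (1ℤ + κ) * (u⁺ + v⁺ - (b + c))

    -- Since w ≤ b + c, `slope` bounds the left side by (x + κ)(c - b): `highᵥ` at w = c supplies x
    -- - 1 copies of c - b, and u⁺ ≥ v > c the other κ + 1.
    merge-beyond : ∀ w → w ≤ b + c → c < v → MergeBound w
    merge-beyond w w≤b+c c<v with b <? c
    ... | yes b<c = certify
      (gap (highᵥ c b<c ≤-refl (<⇒≤ c<v)) ⊕ 0≤1+κ ⊗ gap v≤u⁺ ⊕ 0≤1+κ ⊗ gap (<⇒≤ c<v)
        ⊕ 0≤x ⊗ gap w≤b+c ⊕ slope-≥)
      (eq κ x a b c v u⁺ v⁺ w)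
      where
      eq : ∀ κ x a b c v u⁺ v⁺ w →
        ((1ℤ + κ) * (v⁺ - c) - (x - 1ℤ) * (c - b)) + (1ℤ + κ) * (u⁺ - v)
          + (1ℤ + κ) * (v - c) + x * (b + c - w) + (κ * (c - b) - x * (b - a))
        ≡ (1ℤ + κ) * (u⁺ + v⁺ - (b + c)) - x * (w - (a + b))
      eq = solve-∀
    -- Here b = c, so `highᵥ` covers no w; `slope` gives x(b - a) = 0, and u⁺, v⁺ ≥ v > c suffices.
    ... | no b≮c = certify
      (0≤1+κ ⊗ (gap v≤v⁺ ⊕ gap v≤u⁺ ⊕ gap (<⇒≤ c<v) ⊕ gap (<⇒≤ c<v))
        ⊕ 0≤x ⊗ gap w≤b+c ⊕ slope-≥ ⊕ gap b≤c ⊕ 0≤x ⊗ gap (≮⇒≥ b≮c))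
      (eq κ x a b c v u⁺ v⁺ w)
      where
      eq : ∀ κ x a b c v u⁺ v⁺ w →
        (1ℤ + κ) * ((v⁺ - v) + (u⁺ - v) + (v - c) + (v - c)) + x * (b + c - w)
          + (κ * (c - b) - x * (b - a)) + (c - b) + x * (b - c)
        ≡ (1ℤ + κ) * (u⁺ + v⁺ - (b + c)) - x * (w - (a + b))
      eq = solve-∀

    merge-straddling : ∀ w → w ≤ b + c → w ≤ u + v → b < v → v ≤ c → MergeBound w
    merge-straddling w w≤b+c w≤u+v b<v v≤c with x * (u - a) ≤? κ * (v - b)
    -- Whichever of the bounds u⁺ ≥ v and lowᵤ is the stronger one is used for u⁺.
    ... | yes flat = certify
      (gap (highᵥ v b<v v≤c ≤-refl) ⊕ 0≤1+κ ⊗ gap v≤u⁺ ⊕ gap flat ⊕ 0≤x ⊗ gap w≤u+v)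
      (eq κ x a b c u v u⁺ v⁺ w)
      where
      eq : ∀ κ x a b c u v u⁺ v⁺ w →
        ((1ℤ + κ) * (v⁺ - c) - (x - 1ℤ) * (v - b)) + (1ℤ + κ) * (u⁺ - v)
          + (κ * (v - b) - x * (u - a)) + x * (u + v - w)
        ≡ (1ℤ + κ) * (u⁺ + v⁺ - (b + c)) - x * (w - (a + b))
      eq = solve-∀
    ... | no ¬flat = split
      where
      steep : κ * (v - b) < x * (u - a)
      steep = ≰⇒> ¬flat

      0<x[u-a] : 0ℤ < x * (u - a)
      0<x[u-a] = ≤-<-trans (0≤κ ⊗ gap (<⇒≤ b<v)) steep

      a<u : a < u
      a<u = ≰⇒> λ u≤a → <⇒≱ 0<x[u-a] (certify (0≤x ⊗ gap u≤a) (eq x a u))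
        where
        eq : ∀ x a u → x * (a - u) ≡ 0ℤ - x * (u - a)
        eq = solve-∀

      1≤x : 1ℤ ≤ x
      1≤x = i<j⇒suc[i]≤j {0ℤ} (≰⇒> λ x≤0 →
        <⇒≱ 0<x[u-a] (certify (gap x≤0 ⊗ gap (<⇒≤ a<u)) (eq x a u)))
        where
        eq : ∀ x a u → (0ℤ - x) * (u - a) ≡ 0ℤ - x * (u - a)
        eq = solve-∀

      split : MergeBound w
      split with u ≤? b
      -- The factors κ of `lowᵤ` and 1 + κ of `highᵥ` are reconciled by multiplying the goal by κ;
      -- `steep` absorbs the remainder.
      ... | yes u≤b = *-cancelˡ-≤-pos (x * (w - (a + b))) _ κ (certify
        (0≤1+κ ⊗ gap (lowᵤ u a<u u≤b ≤-refl) ⊕ 0≤κ ⊗ gap (highᵥ v b<v v≤c ≤-refl)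
          ⊕ gap (<⇒≤ steep) ⊕ 0≤κ ⊗ (0≤x ⊗ gap w≤u+v))
        (eq κ x a b c u v u⁺ v⁺ w))
        where
        eq : ∀ κ x a b c u v u⁺ v⁺ w →
          (1ℤ + κ) * (κ * (u⁺ - b) - x * (u - a))
            + κ * ((1ℤ + κ) * (v⁺ - c) - (x - 1ℤ) * (v - b))
            + (x * (u - a) - κ * (v - b)) + κ * (x * (u + v - w))
          ≡ κ * ((1ℤ + κ) * (u⁺ + v⁺ - (b + c))) - κ * (x * (w - (a + b)))
        eq = solve-∀
      -- Both halves lie between b and c, where the bounds have x - 1 in place of x; `slope` and w ≤
      -- b + c make up the difference.
      ... | no u≰b = certify
        (gap (highᵤ u (≰⇒> u≰b) (≤-trans u≤v v≤c) ≤-refl) ⊕ gap (highᵥ v b<v v≤c ≤-refl)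
          ⊕ gap 1≤x ⊗ gap w≤u+v ⊕ gap w≤b+c ⊕ slope-≥)
        (eq κ x a b c u v u⁺ v⁺ w)
        where
        eq : ∀ κ x a b c u v u⁺ v⁺ w →
          ((1ℤ + κ) * (u⁺ - c) - (x - 1ℤ) * (u - b))
            + ((1ℤ + κ) * (v⁺ - c) - (x - 1ℤ) * (v - b))
            + (x - 1ℤ) * (u + v - w) + (b + c - w) + (κ * (c - b) - x * (b - a))
          ≡ (1ℤ + κ) * (u⁺ + v⁺ - (b + c)) - x * (w - (a + b))
        eq = solve-∀

    -- The two lower-piece bounds add up to the claim with κ instead of 1 + κ. The missing summand
    -- is nonnegative by that same weaker bound.
    merge-below : ∀ w → a + b < w → w ≤ u + v → v ≤ b → MergeBound w
    merge-below w a+b<w w≤u+v v≤b = certify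
      (gap weak ⊕ nonneg) (eq κ x a b c u⁺ v⁺ w)
      where
      a<u : a < u
      a<u = ≰⇒> λ u≤a → <⇒≱ a+b<w (≤-trans w≤u+v (+-mono-≤ u≤a v≤b))

      u≤b : u ≤ b
      u≤b = ≤-trans u≤v v≤b

      weak : x * (w - (a + b)) ≤ κ * (u⁺ + v⁺ - (b + c))
      weak = certify
        (gap (lowᵤ u a<u u≤b ≤-refl) ⊕ gap (lowᵥ v (<-≤-trans a<u u≤v) v≤b ≤-refl)
          ⊕ 0≤x ⊗ gap w≤u+v ⊕ slope-≤)
        (eq′ κ x a b c u v u⁺ v⁺ w)
        where
        eq′ : ∀ κ x a b c u v u⁺ v⁺ w →
          (κ * (u⁺ - b) - x * (u - a)) + (κ * (v⁺ - b) - x * (v - a)) + x * (u + v - w)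
            + (x * (b - a) - κ * (c - b))
          ≡ κ * (u⁺ + v⁺ - (b + c)) - x * (w - (a + b))
        eq′ = solve-∀

      nonneg : 0ℤ ≤ u⁺ + v⁺ - (b + c)
      nonneg = *-cancelˡ-≤-pos 0ℤ _ κ (subst (_≤ κ * (u⁺ + v⁺ - (b + c))) (sym (*-zeroʳ κ))
        (≤-trans (0≤x ⊗ gap (<⇒≤ a+b<w)) weak))

      eq : ∀ κ x a b c u⁺ v⁺ w →
        (κ * (u⁺ + v⁺ - (b + c)) - x * (w - (a + b))) + (u⁺ + v⁺ - (b + c))
        ≡ (1ℤ + κ) * (u⁺ + v⁺ - (b + c)) - x * (w - (a + b))
      eq = solve-∀

    merge : ∀ w → a + b < w → w ≤ b + c → w ≤ u + v → MergeBound w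
    merge w a+b<w w≤b+c w≤u+v with v ≤? b | v ≤? c
    ... | yes v≤b | _       = merge-below w a+b<w w≤u+v v≤b
    ... | no  v≰b | yes v≤c = merge-straddling w w≤b+c w≤u+v (≰⇒> v≰b) v≤c
    ... | no  _   | no  v≰c = merge-beyond w w≤b+c (≰⇒> v≰c)

  -- Sizes of Hamming balls

  -- ball m k is the number of subsets of an m-element set with fewer than k
  -- elements, so that the empty ball is ball m 0.
  ball : ℕ → ℕ → ℤ
  ball m       zero    = 0ℤ
  ball zero    (suc k) = 1ℤ
  ball (suc m) (suc k) = ball m k + ball m (suc k)

  ball-suc : ∀ m k → ball m (suc k) ≡ ball m k + + (m C k)
  ball-suc zero    zero    = refl
  ball-suc zero    (suc k) = refl
  ball-suc (suc m) zero    = begin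
    0ℤ + ball m 1      ≡⟨ +-identityˡ (ball m 1) ⟩
    ball m 1           ≡⟨ ball-suc m 0 ⟩
    0ℤ + + (m C 0)     ∎
    where open ≡-Reasoning
  ball-suc (suc m) (suc k) = begin
    ball m (suc k) + ball m (2 ℕ.+ k)
      ≡⟨ cong₂ _+_ (ball-suc m k) (ball-suc m (suc k)) ⟩
    ball m k + + (m C k) + (ball m (suc k) + + (m C suc k))
      ≡⟨ interchange (ball m k) (+ (m C k)) (ball m (suc k)) (+ (m C suc k)) ⟩
    ball m k + ball m (suc k) + + (m C k ℕ.+ m C suc k)
      ≡⟨ cong (λ c → ball m k + ball m (suc k) + + c) (nCk+nC[k+1]≡[n+1]C[k+1] m k) ⟩
    ball m k + ball m (suc k) + + (suc m C suc k) ∎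
    where
    open ≡-Reasoning
    interchange : ∀ a b c d → a + b + (c + d) ≡ a + c + (b + d)
    interchange = solve-∀

  ball-mono : ∀ m k → ball m k ≤ ball m (suc k)
  ball-mono m k = subst (ball m k ≤_) (sym (ball-suc m k)) (i≤i+j (ball m k) (+ (m C k)))

  -- This is (k+1)·C(m,k+1) = (m-k)·C(m,k); for k > m both differences of balls are zero. The
  -- inductive step adds the identities for two neighbouring radii.
  ball-slope : ∀ m k →
    + suc k * (ball m (2 ℕ.+ k) - ball m (suc k)) ≡ (+ m - + k) * (ball m (suc k) - ball m k)
  ball-slope zero    zero    = refl
  ball-slope zero    (suc k) = trans (*-zeroʳ (+ suc (suc k))) (sym (*-zeroʳ (+ 0 - + suc k)))
  ball-slope (suc m) zero    = pascal (+ m) (ball m 1) (ball m 2) (ball-slope m 0)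
    where
    eq₁ : ∀ s₁ s₂ → 1ℤ * (s₁ + s₂ - (0ℤ + s₁)) ≡ s₁ + 1ℤ * (s₂ - s₁)
    eq₁ = solve-∀
    eq₂ : ∀ x s₁ → s₁ + (x - 0ℤ) * (s₁ - 0ℤ) ≡ (1ℤ + x - 0ℤ) * (0ℤ + s₁ - 0ℤ)
    eq₂ = solve-∀
    pascal : ∀ x s₁ s₂ → 1ℤ * (s₂ - s₁) ≡ (x - 0ℤ) * (s₁ - 0ℤ) →
      1ℤ * (s₁ + s₂ - (0ℤ + s₁)) ≡ (1ℤ + x - 0ℤ) * (0ℤ + s₁ - 0ℤ)
    pascal x s₁ s₂ h = trans (eq₁ s₁ s₂) (trans (cong (_+_ s₁) h) (eq₂ x s₁))
  ball-slope (suc m) (suc k) =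
    pascal (+ m) (+ k) (ball m k) (ball m (1 ℕ.+ k)) (ball m (2 ℕ.+ k)) (ball m (3 ℕ.+ k))
      (ball-slope m k) (ball-slope m (suc k))
    where
    eq₁ : ∀ y s₁ s₂ s₃ → (1ℤ + (1ℤ + y)) * (s₂ + s₃ - (s₁ + s₂))
      ≡ (1ℤ + y) * (s₂ - s₁) + (1ℤ + (1ℤ + y)) * (s₃ - s₂) + (s₂ - s₁)
    eq₁ = solve-∀
    eq₂ : ∀ x y s₀ s₁ s₂ → (x - y) * (s₁ - s₀) + (x - (1ℤ + y)) * (s₂ - s₁) + (s₂ - s₁)
      ≡ (1ℤ + x - (1ℤ + y)) * (s₁ + s₂ - (s₀ + s₁))
    eq₂ = solve-∀
    pascal : ∀ x y s₀ s₁ s₂ s₃ →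
      (1ℤ + y) * (s₂ - s₁) ≡ (x - y) * (s₁ - s₀) →
      (1ℤ + (1ℤ + y)) * (s₃ - s₂) ≡ (x - (1ℤ + y)) * (s₂ - s₁) →
      (1ℤ + (1ℤ + y)) * (s₂ + s₃ - (s₁ + s₂)) ≡ (1ℤ + x - (1ℤ + y)) * (s₁ + s₂ - (s₀ + s₁))
    pascal x y s₀ s₁ s₂ s₃ h₀ h₁ = trans (eq₁ y s₁ s₂ s₃)
      (trans (cong₂ (λ p q → p + q + (s₂ - s₁)) h₀ h₁) (eq₂ x y s₀ s₁ s₂))

  double : ∀ m → + (2 ℕ.^ m) + + (2 ℕ.^ m) ≡ + (2 ℕ.^ suc m)
  double m = cong (λ n → + (2 ℕ.^ m ℕ.+ n)) (sym (ℕ.+-identityʳ (2 ℕ.^ m)))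

  ball-full : ∀ {m k} → m ℕ.≤ k → ball m (suc k) ≡ + (2 ℕ.^ m)
  ball-full {zero}              z≤n       = refl
  ball-full {suc m} {k = suc k} (s≤s m≤k) =
    trans (cong₂ _+_ (ball-full m≤k) (ball-full (ℕ.m≤n⇒m≤1+n m≤k))) (double m)

  -- Complementation turns the sets with fewer than k elements into those with at least l.
  ball-complement : ∀ m k l → k ℕ.+ l ≡ suc m → ball m k + ball m l ≡ + (2 ℕ.^ m)
  ball-complement m zero l refl = trans (+-identityˡ (ball m l)) (ball-full {m} ℕ.≤-refl)
  ball-complement m (suc k) zero k≡m =
    trans (+-identityʳ (ball m (suc k)))
      (ball-full (ℕ.≤-reflexive (sym (ℕ.suc-injective (trans (sym (ℕ.+-identityʳ (suc k))) k≡m)))))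
  ball-complement zero (suc zero)    (suc l) ()
  ball-complement zero (suc (suc k)) (suc l) ()
  ball-complement (suc m) (suc k) (suc l) eq = begin
    ball m k + ball m (suc k) + (ball m l + ball m (suc l))
      ≡⟨ crosswise (ball m k) (ball m (suc k)) (ball m l) (ball m (suc l)) ⟩
    ball m k + ball m (suc l) + (ball m (suc k) + ball m l)
      ≡⟨ cong₂ _+_ (ball-complement m k (suc l) eq′)
                   (ball-complement m (suc k) l (trans (sym (ℕ.+-suc k l)) eq′)) ⟩
    + (2 ℕ.^ m) + + (2 ℕ.^ m)
      ≡⟨ double m ⟩
    + (2 ℕ.^ suc m) ∎
    where
    open ≡-Reasoning
    eq′ = ℕ.suc-injective eq
    crosswise : ∀ a b c d → a + b + (c + d) ≡ a + d + (b + c)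
    crosswise = solve-∀

  -- Growth of down-sets

  -- N⁺ ≥ φ(w) for every w ≤ N, where φ interpolates ball m k ↦ ball m (suc k)
  -- linearly; its slope on the k-th piece is C(m,k+1)/C(m,k) = (m−k)/(k+1).  The
  -- strict lower bound on w is needed at k = 0, as an empty set does not grow.
  Growth : ℕ → ℤ → ℤ → Set
  Growth m N N⁺ = ∀ k w → ball m k < w → w ≤ ball m (suc k) → w ≤ N →
    (+ m - + k) * (w - ball m k) ≤ + suc k * (N⁺ - ball m (suc k))

  growth-zero : ∀ {N N⁺} → N ≤ N⁺ → Growth 0 N N⁺
  growth-zero {N} {N⁺} N≤N⁺ zero w 0<w w≤1 w≤N =
    subst₂ _≤_ (sym (*-zeroˡ (w - 0ℤ))) (sym (*-identityˡ (N⁺ - 1ℤ)))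
      (gap (≤-trans (i<j⇒suc[i]≤j {0ℤ} 0<w) (≤-trans w≤N N≤N⁺)))
  growth-zero N≤N⁺ (suc k) w 1<w w≤1 _ = contradiction w≤1 (<⇒≱ 1<w)

  -- For k > 0 Pascal's rule brings the claim into the form of `merge`. For k = 0 no ball precedes
  -- the empty one; there w ≤ 1, `growᵥ` gives v⁺ ≥ m + 1, and u⁺ ≥ v ≥ 1.
  growth-suc : ∀ {m u v u⁺ v⁺} → u ≤ v → v ≤ u⁺ → v ≤ v⁺ →
    Growth m u u⁺ → Growth m v v⁺ → Growth (suc m) (v + u) (v⁺ + u⁺)
  growth-suc {m} {u} {v} {u⁺} {v⁺} u≤v v≤u⁺ v≤v⁺ growᵤ growᵥ zero w 0<w w≤b w≤v+u =
    certify
      (nonneg ⊗ gap w≤1 ⊕ gap slopeᵥ ⊕ gap v≤u⁺ ⊕ gap 1≤v)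
      (trans (eq (+ m) w v v⁺ u⁺) (cong (λ b → 1ℤ * (v⁺ + u⁺ - (0ℤ + b)) - (1ℤ + + m - 0ℤ) * (w - 0ℤ)) (sym b≡1)))
    where
    b≡1 : ball m 1 ≡ 1ℤ
    b≡1 = ball-suc m 0

    nonneg : 0ℤ ≤ 1ℤ + + m
    nonneg = +≤+ z≤n

    w≤1 : w ≤ 1ℤ
    w≤1 = subst (w ≤_) (trans (+-identityˡ (ball m 1)) b≡1) w≤b

    1≤v : 1ℤ ≤ v
    1≤v = i<j⇒suc[i]≤j {0ℤ} (≰⇒> λ v≤0 →
      <⇒≱ 0<w (≤-trans w≤v+u (+-mono-≤ v≤0 (≤-trans u≤v v≤0))))

    slopeᵥ : (+ m - 0ℤ) * (1ℤ - 0ℤ) ≤ 1ℤ * (v⁺ - 1ℤ)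
    slopeᵥ = subst (λ b → (+ m - 0ℤ) * (1ℤ - 0ℤ) ≤ 1ℤ * (v⁺ - b)) b≡1
      (growᵥ 0 1ℤ (+<+ (s≤s z≤n)) (≤-reflexive (sym b≡1)) 1≤v)

    eq : ∀ m w v v⁺ u⁺ →
      (1ℤ + m) * (1ℤ - w) + (1ℤ * (v⁺ - 1ℤ) - (m - 0ℤ) * (1ℤ - 0ℤ)) + (u⁺ - v) + (v - 1ℤ)
      ≡ 1ℤ * (v⁺ + u⁺ - (0ℤ + 1ℤ)) - (1ℤ + m - 0ℤ) * (w - 0ℤ)
    eq = solve-∀
  growth-suc {m} {u} {v} {u⁺} {v⁺} u≤v v≤u⁺ v≤v⁺ growᵤ growᵥ (suc k) w b<w w≤b w≤v+u
    with k ℕ.≤? m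
  -- For k > m both balls are the whole cube, so no w lies between them. Otherwise x = m - k is
  -- nonnegative, as `merge` requires.
  ... | no  k≰m = contradiction (subst (w ≤_) full w≤b) (<⇒≱ b<w)
    where
    m<k = ℕ.≰⇒> k≰m
    full : ball (suc m) (2 ℕ.+ k) ≡ ball (suc m) (suc k)
    full = trans (ball-full (ℕ.m≤n⇒m≤1+n m<k)) (sym (ball-full m<k))
  ... | yes k≤m = subst₂
      (λ x N⁺ → x * (w - (ball m k + ball m (suc k)))
        ≤ + (2 ℕ.+ k) * (N⁺ - (ball m (suc k) + ball m (2 ℕ.+ k))))
      (shift (+ m) (+ k)) (+-comm u⁺ v⁺)
      (merge k (gap (+≤+ k≤m)) (ball-mono m (suc k)) (ball-slope m k) u≤v v≤u⁺ v≤v⁺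
        (growᵤ k) (growᵥ k) (high {u} {u⁺} growᵤ) (high {v} {v⁺} growᵥ)
        w b<w w≤b (subst (w ≤_) (+-comm v u) w≤v+u))
    where
    shift : ∀ x y → x - y ≡ 1ℤ + x - (1ℤ + y)
    shift = solve-∀

    predecessor : ∀ x y → x - (1ℤ + y) ≡ x - y - 1ℤ
    predecessor = solve-∀

    high : ∀ {N N⁺} → Growth m N N⁺ → ∀ w → ball m (suc k) < w → w ≤ ball m (2 ℕ.+ k) → w ≤ N →
      (+ m - + k - 1ℤ) * (w - ball m (suc k)) ≤ + (2 ℕ.+ k) * (N⁺ - ball m (2 ℕ.+ k))
    high {N⁺ = N⁺} grow w p q r =
      subst (λ x → x * (w - ball m (suc k)) ≤ + (2 ℕ.+ k) * (N⁺ - ball m (2 ℕ.+ k)))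
        (predecessor (+ m) (+ k)) (grow (suc k) w p q r)

  -- In dimension m = 2r + 1 the ball `b` is exactly half the cube, whence L ≤ b ≤ N. The slope (m -
  -- r)/(r + 1) at this radius is 1, so the growth beyond b is at least the sphere size C(m,r).
  growth-median : ∀ r {N L N⁺} → N + L ≡ + (2 ℕ.^ suc (r ℕ.+ r)) → L ≤ N → N ≤ N⁺ →
    Growth (suc (r ℕ.+ r)) N N⁺ → L + + (suc (r ℕ.+ r) C r) ≤ N⁺
  growth-median r {N} {L} {N⁺} N+L≡2ᵐ L≤N N≤N⁺ grow =
    ≤-trans (+-monoˡ-≤ (+ (m C r)) L≤b) (certify (gap jump) (regroup N⁺ b (+ (m C r))))
    where
    m = suc (r ℕ.+ r)
    b = ball m (suc r)

    b+b≡N+L : b + b ≡ N + L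
    b+b≡N+L = trans (ball-complement m (suc r) (suc r) (cong suc (ℕ.+-suc r r))) (sym N+L≡2ᵐ)

    b≤N : b ≤ N
    b≤N = ≮⇒≥ λ N<b →
      <⇒≱ (+-mono-< N<b N<b) (≤-trans (≤-reflexive b+b≡N+L) (+-monoʳ-≤ N L≤N))

    L≤b : L ≤ b
    L≤b = ≮⇒≥ λ b<L →
      <⇒≱ (+-mono-< b<L b<L) (≤-trans (+-monoˡ-≤ L L≤N) (≤-reflexive (sym b+b≡N+L)))

    regroup : ∀ N s c → N - s - c ≡ N - (s + c)
    regroup = solve-∀

    sphere : b - ball m r ≡ + (m C r)
    sphere = trans (cong (_- ball m r) (ball-suc m r)) (cancel (ball m r) (+ (m C r)))
      where
      cancel : ∀ s c → s + c - s ≡ c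
      cancel = solve-∀

    codim : + m - + r ≡ + suc r
    codim = cancel (+ r)
      where
      cancel : ∀ y → 1ℤ + (y + y) - y ≡ 1ℤ + y
      cancel = solve-∀

    jump : + (m C r) ≤ N⁺ - b
    jump with ball m r <? b
    ... | yes r<1+r = *-cancelˡ-≤-pos _ _ (+ suc r) (subst (_≤ + suc r * (N⁺ - b))
      (cong₂ _*_ codim sphere) (grow r b r<1+r ≤-refl b≤N))
    -- Without the strict bound that `Growth` asks for, the sphere size is at most 0 and b ≤ N ≤ N⁺
    -- suffices.
    ... | no  r≮1+r = subst (_≤ N⁺ - b) sphere
      (≤-trans (i≤j⇒i-j≤0 (≮⇒≥ r≮1+r)) (gap (≤-trans b≤N N≤N⁺)))

open Isoperimetry using (certify; gap; Growth; growth-zero; growth-suc; growth-median)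
open import Data.Nat.Base using (ℕ; zero; suc; _+_; _*_; _∸_; _^_; _≤_; _<_; _≮_;
  z≤n; s≤s; NonZero; ⌊_/2⌋; ⌈_/2⌉; +-0-rawMonoid)
open import Data.Nat.Properties
open import Data.Nat.Tactic.RingSolver using (solve-∀)

-- Counting subset sums below a threshold

total : ∀ {m} → Vector ℕ m → ℕ
total = sum +-0-rawMonoid

-- below a c t is the number of I with c + subsetSum a I < t; the offset c avoids
-- thresholds t − c.
below : ∀ {m} → Vector ℕ m → ℕ → ℕ → ℕ
below {zero}  a c t = if does (c <? t) then 1 else 0
below {suc m} a c t = below (tail a) c t + below (tail a) (c + head a) t

below-zero-< : ∀ (a : Vector ℕ 0) {c t} → c < t → below a c t ≡ 1
below-zero-< a {c} {t} c<t = cong (if_then 1 else 0) (dec-true (c <? t) c<t)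

below-zero-≮ : ∀ (a : Vector ℕ 0) {c t} → c ≮ t → below a c t ≡ 0
below-zero-≮ a {c} {t} c≮t = cong (if_then 1 else 0) (dec-false (c <? t) c≮t)

-- The hypothesis is t - c ≤ t′ - c′, stated without truncated subtraction; only this effective
-- threshold matters.
below-mono : ∀ {m} (a : Vector ℕ m) {c t c′ t′} → t + c′ ≤ t′ + c → below a c t ≤ below a c′ t′
below-mono {zero} a {c} {t} {c′} {t′} h with c <? t
... | no  c≮t = subst (_≤ below a c′ t′) (sym (below-zero-≮ a c≮t)) z≤n
... | yes c<t = ≤-reflexive (trans (below-zero-< a c<t) (sym (below-zero-< a c′<t′)))
  where
  c′<t′ : c′ < t′
  c′<t′ = +-cancelˡ-< c c′ t′ (subst (c + c′ <_) (+-comm t′ c) (<-≤-trans (+-monoˡ-< c′ c<t) h))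
below-mono {suc m} a {c} {t} {c′} {t′} h =
  +-mono-≤ (below-mono (tail a) h) (below-mono (tail a) h′)
  where
  h′ : t + (c′ + head a) ≤ t′ + (c + head a)
  h′ = subst₂ _≤_ (+-assoc t c′ (head a)) (+-assoc t′ c (head a)) (+-monoˡ-≤ (head a) h)

-- A subset misses the threshold t exactly when its complement lies below t′; the `suc` accounts for
-- both inequalities being strict.
below-complement : ∀ {m} (a : Vector ℕ m) {c t c′ t′} → t + t′ ≡ suc (c + c′ + total a) →
  below a c t + below a c′ t′ ≡ 2 ^ m
below-complement {zero} a {c} {t} {c′} {t′} h with c <? t | c′ <? t′
... | yes c<t | no c′≮t′  = cong₂ _+_ (below-zero-< a c<t) (below-zero-≮ a c′≮t′)
... | no c≮t  | yes c′<t′ = cong₂ _+_ (below-zero-≮ a c≮t) (below-zero-< a c′<t′)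
... | yes c<t | yes c′<t′ = contradiction
  (≤-trans (+-mono-≤ c<t c′<t′) (≤-reflexive (trans h (cong suc (+-identityʳ (c + c′))))))
  (<⇒≱ (≤-reflexive (cong suc (sym (+-suc c c′)))))
... | no  c≮t | no  c′≮t′ = contradiction
  (≤-trans (≤-reflexive (sym (trans h (cong suc (+-identityʳ (c + c′))))))
    (+-mono-≤ (≮⇒≥ c≮t) (≮⇒≥ c′≮t′)))
  (<⇒≱ ≤-refl)
below-complement {suc m} a {c} {t} {c′} {t′} h = begin
  below b c t + below b (c + e) t + (below b c′ t′ + below b (c′ + e) t′)
    ≡⟨ crosswise (below b c t) (below b (c + e) t) (below b c′ t′) (below b (c′ + e) t′) ⟩
  below b c t + below b (c′ + e) t′ + (below b (c + e) t + below b c′ t′)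
    ≡⟨ cong₂ _+_ (below-complement b (trans h (cong suc (eq₁ c c′ e (total b)))))
                 (below-complement b (trans h (cong suc (eq₂ c c′ e (total b))))) ⟩
  2 ^ m + 2 ^ m
    ≡⟨ cong (_+_ (2 ^ m)) (+-identityʳ (2 ^ m)) ⟨
  2 ^ suc m ∎
  where
  open ≡-Reasoning
  b = tail a
  e = head a
  crosswise : ∀ x y z w → x + y + (z + w) ≡ x + w + (y + z)
  crosswise = solve-∀
  eq₁ : ∀ c c′ e s → c + c′ + (e + s) ≡ c + (c′ + e) + s
  eq₁ = solve-∀
  eq₂ : ∀ c c′ e s → c + c′ + (e + s) ≡ c + e + c′ + s
  eq₂ = solve-∀

-- `below` recurses on the first element, while the even case splits off the last, which is the
-- largest.
below-snoc : ∀ {m} (a : Vector ℕ (suc m)) c t →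
  below a c t ≡ below (init a) c t + below (init a) (c + last a) t
below-snoc {zero}  a c t = refl
below-snoc {suc m} a c t = begin
  below b c t + below b (c + e) t
    ≡⟨ cong₂ _+_ (below-snoc b c t) (below-snoc b (c + e) t) ⟩
  x c + x (c + l) + (x (c + e) + x (c + e + l))
    ≡⟨ cong (λ s → x c + x (c + l) + (x (c + e) + x s)) (swap c e l) ⟩
  x c + x (c + l) + (x (c + e) + x (c + l + e))
    ≡⟨ interchange (x c) (x (c + l)) (x (c + e)) (x (c + l + e)) ⟩
  x c + x (c + e) + (x (c + l) + x (c + l + e)) ∎
  where
  open ≡-Reasoning
  b = tail a
  e = head a
  l = last a
  x = λ c → below (init b) c t
  swap : ∀ c e l → c + e + l ≡ c + l + e
  swap = solve-∀
  interchange : ∀ x y z w → x + y + (z + w) ≡ x + z + (y + w)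
  interchange = solve-∀

-- Here u counts the sets containing the first element e and v those avoiding it. The condition v ≤
-- u⁺ of `growth-suc` is where e ≤ A enters.
below-growth : ∀ {m} (a : Vector ℕ m) {A} → (∀ i → a i ≤ A) → ∀ c t →
  Growth m (+ below a c t) (+ below a c (t + A))
below-growth {zero} a {A} _ c t = growth-zero
  (+≤+ (below-mono a {c} {t} {c} {t + A} (+-monoˡ-≤ c (m≤m+n t A))))
below-growth {suc m} a {A} a≤A c t = growth-suc
  (+≤+ (below-mono b (+-monoʳ-≤ t (m≤m+n c e))))
  (+≤+ (below-mono b shift))
  (+≤+ (below-mono b (+-monoˡ-≤ c (m≤m+n t A))))
  (below-growth b (a≤A ∘ suc) (c + e) t)
  (below-growth b (a≤A ∘ suc) c t)
  where
  b = tail a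
  e = head a
  swap : ∀ t c e → t + (c + e) ≡ t + e + c
  swap = solve-∀
  shift : t + (c + e) ≤ t + A + c
  shift = subst (_≤ t + A + c) (sym (swap t c e)) (+-monoˡ-≤ c (+-monoʳ-≤ t (a≤A zero)))

-- From thresholds to representations

module _ {m} {P : Pred (Subset (suc m)) 0ℓ} (P? : Decidable P) where

  length-filter-map : ∀ x Is → length (filter P? (List.map (x Vec.∷_) Is))
    ≡ length (filter (P? ∘ (x Vec.∷_)) Is)
  length-filter-map x List.[]      = refl
  length-filter-map x (I ∷ Is) with does (P? (x Vec.∷ I))
  ... | true  = cong suc (length-filter-map x Is)
  ... | false = length-filter-map x Is

  length-filter-subsets : length (filter P? (subsets (suc m)))
    ≡ length (filter (P? ∘ (outside Vec.∷_)) (subsets m))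
      + length (filter (P? ∘ (inside Vec.∷_)) (subsets m))
  length-filter-subsets = begin
    length (filter P? (out List.++ inn))
      ≡⟨ cong length (List.filter-++ P? out inn) ⟩
    length (filter P? out List.++ filter P? inn)
      ≡⟨ List.length-++ (filter P? out) ⟩
    length (filter P? out) + length (filter P? inn)
      ≡⟨ cong₂ _+_ (length-filter-map outside (subsets m)) (length-filter-map inside (subsets m)) ⟩
    length (filter (P? ∘ (outside Vec.∷_)) (subsets m))
      + length (filter (P? ∘ (inside Vec.∷_)) (subsets m)) ∎
    where
    open ≡-Reasoning
    out = List.map (outside Vec.∷_) (subsets m)
    inn = List.map (inside Vec.∷_) (subsets m)

below-suc : ∀ {m} (a : Vector ℕ m) c t → below a c (suc t)
  ≡ below a c t + length (filter (λ I → c + subsetSum a I ≟ t) (subsets m))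
below-suc {zero} a c t with <-cmp c t
... | tri< c<t c≢t _ = trans (below-zero-< a (m<n⇒m<1+n c<t)) (sym (cong₂ _+_ (below-zero-< a c<t)
  (cong length (List.filter-reject (λ I → c + subsetSum a I ≟ t) λ eq → c≢t (trans (sym (+-identityʳ c)) eq)))))
... | tri≈ c≮t c≡t _ = trans (below-zero-< a (s≤s (≤-reflexive c≡t))) (sym (cong₂ _+_ (below-zero-≮ a c≮t)
  (cong length (List.filter-accept (λ I → c + subsetSum a I ≟ t) (trans (+-identityʳ c) c≡t)))))
... | tri> c≮t c≢t t<c = trans (below-zero-≮ a (<⇒≱ (s≤s t<c))) (sym (cong₂ _+_ (below-zero-≮ a c≮t)
  (cong length (List.filter-reject (λ I → c + subsetSum a I ≟ t) λ eq → c≢t (trans (sym (+-identityʳ c)) eq)))))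
below-suc {suc m} a c t = begin
  below b c (suc t) + below b (c + e) (suc t)
    ≡⟨ cong₂ _+_ (below-suc b c t) (below-suc b (c + e) t) ⟩
  below b c t + rep c + (below b (c + e) t + rep (c + e))
    ≡⟨ interchange (below b c t) (rep c) (below b (c + e) t) (rep (c + e)) ⟩
  below a c t + (rep c + rep (c + e))
    ≡⟨ cong (λ r → below a c t + (rep c + r)) (cong length (List.filter-≐ _ _ assoc (subsets m))) ⟩
  below a c t + (rep c + length (filter (λ I → c + (e + subsetSum b I) ≟ t) (subsets m)))
    ≡⟨ cong (_+_ (below a c t)) (length-filter-subsets (λ I → c + subsetSum a I ≟ t)) ⟨
  below a c t + length (filter (λ I → c + subsetSum a I ≟ t) (subsets (suc m))) ∎
  where
  open ≡-Reasoning
  b = tail a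
  e = head a
  rep = λ c → length (filter (λ I → c + subsetSum b I ≟ t) (subsets m))
  interchange : ∀ x y z w → x + y + (z + w) ≡ x + z + (y + w)
  interchange = solve-∀
  assoc = (λ {I} → trans (sym (+-assoc c e (subsetSum b I))))
        , (λ {I} → trans (+-assoc c e (subsetSum b I)))

-- Raising the threshold by one admits the representations of a single integer.
below-window : ∀ {m} (a : Vector ℕ m) {g} → (∀ t → representations a t ≤ g) →
  ∀ t n → below a 0 (t + n) ≤ below a 0 t + n * g
below-window a {g} rep≤g t zero    =
  ≤-reflexive (trans (cong (below a 0) (+-identityʳ t)) (sym (+-identityʳ _)))
below-window {m} a {g} rep≤g t (suc n) = begin
  below a 0 (t + suc n)
    ≡⟨ cong (below a 0) (+-suc t n) ⟩
  below a 0 (suc (t + n))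
    ≡⟨ below-suc a 0 (t + n) ⟩
  below a 0 (t + n) + length (filter (λ I → subsetSum a I ≟ t + n) (subsets m))
    ≡⟨ cong (λ Is → below a 0 (t + n) + length Is)
         (List.filter-≐ _ _ (cong (λ s → + s) , ℤ.+-injective) (subsets m)) ⟩
  below a 0 (t + n) + representations a (+ (t + n))
    ≤⟨ +-mono-≤ (below-window a rep≤g t n) (rep≤g (+ (t + n))) ⟩
  below a 0 t + n * g + g
    ≡⟨ rearrange (below a 0 t) (n * g) g ⟩
  below a 0 t + suc n * g ∎
  where
  open ≤-Reasoning
  rearrange : ∀ x y g → x + y + g ≡ x + (g + y)
  rearrange = solve-∀

-- The window around the median

module _ r (a : Vector ℕ (suc (r + r))) {A} (a≤A : ∀ i → a i ≤ A) where

  private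
    t = ⌊ total a /2⌋
    t′ = ⌈ total a /2⌉

  median-split : below a 0 (suc t) + below a 0 t′ ≡ 2 ^ suc (r + r)
  median-split = below-complement a (cong suc (⌊n/2⌋+⌈n/2⌉≡n (total a)))

  median-jump : below a 0 t′ + suc (r + r) C r ≤ below a 0 (suc t + A)
  median-jump = ℤ.drop‿+≤+ (growth-median r (cong (λ s → + s) median-split)
    -- With T = `total a`, the thresholds `t′` and `suc t` unfold to ⌊(T+1)/2⌋ and ⌊(T+2)/2⌋.
    (+≤+ (below-mono a (+-monoˡ-≤ 0 (⌊n/2⌋-mono (n≤1+n (suc (total a)))))))
    (+≤+ (below-mono a (+-monoˡ-≤ 0 (m≤m+n (suc t) A))))
    (below-growth a a≤A 0 (suc t)))

-- The window from ⌈s/2⌉ to ⌊s/2⌋ + A holds A + 1 integers for even s and A for odd s. In the even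
-- case s is the total of the shortened vector.
window-cover : ∀ {m} (a : Vector ℕ m) {g A s w} → (∀ t → representations a t ≤ g) →
  below a 0 ⌈ s /2⌉ + w ≤ below a 0 (suc ⌊ s /2⌋ + A) → w ≤ suc A * g
window-cover a {g} {A} {s} {w} rep≤g w≤ = +-cancelˡ-≤ (below a 0 ⌈ s /2⌉) _ _ (begin
  below a 0 ⌈ s /2⌉ + w
    ≤⟨ w≤ ⟩
  below a 0 (suc ⌊ s /2⌋ + A)
    ≤⟨ below-mono a (+-monoˡ-≤ 0 (subst (suc ⌊ s /2⌋ + A ≤_) (sym (+-suc ⌈ s /2⌉ A))
         (s≤s (+-monoˡ-≤ A (⌊n/2⌋≤⌈n/2⌉ s))))) ⟩
  below a 0 (⌈ s /2⌉ + suc A)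
    ≤⟨ below-window a rep≤g ⌈ s /2⌉ (suc A) ⟩
  below a 0 ⌈ s /2⌉ + suc A * g ∎)
  where open ≤-Reasoning

bound-odd : ∀ r (a : Vector ℕ (suc (r + r))) {g A} → (∀ i → a i ≤ A) →
  (∀ t → representations a t ≤ g) → suc (r + r) C r ≤ suc A * g
bound-odd r a a≤A rep≤g = window-cover a {s = total a} rep≤g (median-jump r a a≤A)

central-even : ∀ r → (2 + (r + r)) C suc r ≡ suc (r + r) C r + suc (r + r) C r
central-even r = begin
  (2 + (r + r)) C suc r
    ≡⟨ nCk+nC[k+1]≡[n+1]C[k+1] (suc (r + r)) r ⟨
  suc (r + r) C r + suc (r + r) C suc r
    ≡⟨ cong (_+_ _) (nCk≡nC[n∸k] {suc r} (s≤s (m≤m+n r r))) ⟩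
  suc (r + r) C r + suc (r + r) C (suc (r + r) ∸ suc r)
    ≡⟨ cong (λ k → suc (r + r) C r + suc (r + r) C k) (m+n∸m≡n r r) ⟩
  suc (r + r) C r + suc (r + r) C r ∎
  where open ≡-Reasoning

-- Sums in the window number p⁺ - q without the last element and p - q⁻ with it. Reflection makes
-- these equal, and `jump` bounds each below by w, half of the central binomial coefficient.
bound-even : ∀ r (a : Vector ℕ (2 + (r + r))) {g} → (∀ i → a i ≤ last a) →
  (∀ t → representations a t ≤ g) → (2 + (r + r)) C suc r ≤ suc (last a) * g
bound-even r a {g} a≤A rep≤g = subst (_≤ suc A * g) (sym (central-even r))
  (window-cover a {s = total b} rep≤g (subst₂ (λ x y → x + (w + w) ≤ y)
    (sym (below-snoc a 0 t′)) (sym (below-snoc a 0 (suc t + A))) doubled))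
  where
  open ≤-Reasoning
  A  = last a
  b  = init a
  t  = ⌊ total b /2⌋
  t′ = ⌈ total b /2⌉
  w  = suc (r + r) C r
  p  = below b 0 (suc t)
  p⁺ = below b 0 (suc t + A)
  q  = below b 0 t′
  q⁻ = below b A t′

  jump : q + w ≤ p⁺
  jump = median-jump r b (a≤A ∘ inject₁)

  swap : ∀ x y z → x + (y + z) ≡ y + x + z
  swap = solve-∀

  -- Both sides are the full cube: t′ - A mirrors suc t + A, and suc t mirrors t′.
  reflect : q⁻ + p⁺ ≡ p + q
  reflect = trans
    (below-complement b (trans (swap t′ (suc t) A) (trans
      (cong (_+ A) (cong suc (⌊n/2⌋+⌈n/2⌉≡n (total b))))
      (cong suc (trans (+-comm (total b) A) (cong (_+ total b) (sym (+-identityʳ A))))))))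
    (sym (median-split r b (a≤A ∘ inject₁)))

  eq₁ : ∀ q q⁻ w p⁺ → q + q⁻ + (w + w) + p⁺ ≡ q + (q⁻ + p⁺) + (w + w)
  eq₁ = solve-∀
  eq₂ : ∀ q p w → q + (p + q) + (w + w) ≡ p + ((q + w) + (q + w))
  eq₂ = solve-∀
  eq₃ : ∀ p p⁺ → p + (p⁺ + p⁺) ≡ p⁺ + p + p⁺
  eq₃ = solve-∀

  doubled : q + q⁻ + (w + w) ≤ p⁺ + below b A (suc t + A)
  doubled = +-cancelʳ-≤ p⁺ _ _ (begin
    q + q⁻ + (w + w) + p⁺               ≡⟨ eq₁ q q⁻ w p⁺ ⟩
    q + (q⁻ + p⁺) + (w + w)             ≡⟨ cong (λ s → q + s + (w + w)) reflect ⟩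
    q + (p + q) + (w + w)               ≡⟨ eq₂ q p w ⟩
    p + ((q + w) + (q + w))             ≤⟨ +-monoʳ-≤ p (+-mono-≤ jump jump) ⟩
    p + (p⁺ + p⁺)                       ≡⟨ eq₃ p p⁺ ⟩
    p⁺ + p + p⁺                         ≤⟨ +-monoˡ-≤ p⁺ (+-monoʳ-≤ p⁺ (below-mono b
                                             (≤-reflexive (sym (+-identityʳ (suc t + A)))))) ⟩
    p⁺ + below b A (suc t + A) + p⁺     ∎)

-- Both parities combined

parity : ∀ n → (∃[ r ] n ≡ r + r) ⊎ (∃[ r ] n ≡ suc (r + r))
parity zero = inj₁ (0 , refl)
parity (suc n) with parity n
... | inj₁ (r , refl) = inj₂ (r , refl)
... | inj₂ (r , refl) = inj₁ (suc r , cong suc (sym (+-suc r r)))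

central-bound : ∀ n (a : Vector ℕ (suc n)) {g} → (∀ i → a i ≤ last a) →
  (∀ t → representations a t ≤ g) → suc n C ⌊ suc n /2⌋ ≤ suc (last a) * g
central-bound n a {g} a≤A rep≤g with parity n
-- The vector has n + 1 entries, so even n is the odd-dimensional case.
... | inj₁ (r , refl) =
  subst (λ k → suc (r + r) C k ≤ suc (last a) * g) (n≡⌈n+n/2⌉ r) (bound-odd r a a≤A rep≤g)
... | inj₂ (r , refl) =
  subst (λ k → (2 + (r + r)) C suc k ≤ suc (last a) * g) (n≡⌊n+n/2⌋ r) (bound-even r a a≤A rep≤g)

last-max : ∀ {n} (a : Vector ℕ (suc n)) → StrictlyIncreasing a → ∀ i → a i ≤ last a
last-max {n} a a-mono i with i Fin.≟ fromℕ n
... | yes refl = ≤-refl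
... | no  i≢n  = <⇒≤ (a-mono (Fin.≤∧≢⇒< (Fin.≤fromℕ i) i≢n))

-- Rational form and conclusion

open import Data.Rational.Base as ℚ using (1ℚ; toℚᵘ; _/_)
import Data.Rational.Properties as ℚ
open import Data.Rational.Unnormalised.Base as ℚᵘ using (mkℚᵘ; *≤*; 1ℚᵘ)
import Data.Rational.Unnormalised.Properties as ℚᵘ

-- In unnormalised rationals the order is cross-multiplied integer order, where the claim is the
-- hypothesis up to a ring identity.
quotient-bound : ∀ g .{{_ : NonZero g}} c l → c ≤ g * (l + 1) →
  ((+ l) / 1) ℚ.≥ (+ 1 / g) ℚ.* (+ c / 1) ℚ.- 1ℚ
quotient-bound g@(suc g-1) c l c≤g[l+1] = ℚ.toℚᵘ-cancel-≤ (begin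
  toℚᵘ ((+ 1 / g) ℚ.* (+ c / 1) ℚ.- 1ℚ)
    ≃⟨ ℚ.toℚᵘ-homo-+ ((+ 1 / g) ℚ.* (+ c / 1)) (ℚ.- 1ℚ) ⟩
  toℚᵘ ((+ 1 / g) ℚ.* (+ c / 1)) ℚᵘ.- 1ℚᵘ
    ≃⟨ ℚᵘ.+-congˡ (ℚᵘ.- 1ℚᵘ) (ℚᵘ.≃-trans (ℚ.toℚᵘ-homo-* (+ 1 / g) (+ c / 1))
         (ℚᵘ.*-cong (ℚ.toℚᵘ-fromℚᵘ (mkℚᵘ (+ 1) g-1)) (ℚ.toℚᵘ-fromℚᵘ (mkℚᵘ (+ c) 0)))) ⟩
  mkℚᵘ (+ 1) g-1 ℚᵘ.* mkℚᵘ (+ c) 0 ℚᵘ.- 1ℚᵘ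
    ≤⟨ *≤* (certify (gap (subst (+ c ℤ.≤_) (ℤ.pos-* g (l + 1)) (+≤+ c≤g[l+1]))) (eq (+ g) (+ c) (+ l))) ⟩
  mkℚᵘ (+ l) 0
    ≃⟨ ℚ.toℚᵘ-fromℚᵘ (mkℚᵘ (+ l) 0) ⟨
  toℚᵘ (+ l / 1) ∎)
  where
  open ℚᵘ.≤-Reasoning
  eq : ∀ g c l → g ℤ.* (l ℤ.+ ℤ.1ℤ) ℤ.- c ≡
    l ℤ.* (g ℤ.* ℤ.1ℤ ℤ.* ℤ.1ℤ) ℤ.- (ℤ.1ℤ ℤ.* c ℤ.* ℤ.1ℤ ℤ.+ (ℤ.- ℤ.1ℤ) ℤ.* (g ℤ.* ℤ.1ℤ)) ℤ.* ℤ.1ℤ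
  eq = ℤ.solve-∀

theorem4 : (g : ℕ) .{{_ : NonZero g}} (n : ℕ) → let m = suc n in
    (a : Vector ℕ m) → StrictlyIncreasing a → 𝒟[ g ] a →
    ((+ last a / 1) ℚ.≥ (+ 1 / g) ℚ.* (+ (m C ⌊ m /2⌋) / 1) ℚ.- 1ℚ)
    × (m C ⌊ m /2⌋ ≤ g * (last a + 1))
theorem4 g n a a-mono a∈𝒟 = quotient-bound g (suc n C ⌊ suc n /2⌋) (last a) bound , bound
  where
  -- At k = m the 𝒟[g] condition speaks of this reindexing, equal to `a` pointwise, so the bound is
  -- proved for `b` and transported.
  b = λ i → a (inject≤ i ≤-refl)

  b≗a : ∀ i → b i ≡ a i
  b≗a i = cong a (Fin.inject≤-refl i ≤-refl)

  b≤last : ∀ i → b i ≤ last b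
  b≤last i = subst₂ _≤_ (sym (b≗a i)) (sym (b≗a (fromℕ n))) (last-max a a-mono i)

  bound : suc n C ⌊ suc n /2⌋ ≤ g * (last a + 1)
  bound = subst (suc n C ⌊ suc n /2⌋ ≤_)
    (trans (*-comm (suc (last b)) g) (cong (g *_) (trans (cong suc (b≗a (fromℕ n))) (+-comm 1 (last a)))))
    (central-bound n b b≤last (a∈𝒟 (suc n) (s≤s z≤n) ≤-refl))
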